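{- Let $\mathcal A$ be a class of function algebras. Then $\mathcal A\mathsf{RA}_2$ is a lifted extension of $\mathcal A\mathsf{RA}_1$; that is, for every sentence $\varphi$ of $L_1(X,\vec f)$ such that $\mathcal A\mathsf{RA}_1\vdash\varphi$ we have $\mathcal A\mathsf{RA}_2\vdash\varphi{\uparrow}$.
   Context: **Language $L_1$ and BASIC.** $L_1$ is the first-order language with constant $0$, unary function symbols $S,H,T$, binary function symbols $+,\cdot$, a binary pairing function symbol $(\cdot,\cdot)$, and a binary relation $<$. Write $1=S(0)$, $2=S(S(0))$, and $x\le y$ for $x<y\lor x=y$. Pairing associates to the right, and $f(x,y)$ means $f((x,y))$. BASIC consists of the universal closures of: $S(x)\neq 0$; $S(x)=S(y)\to x=y$; $x+0=x$; $x+S(y)=S(x+y)$; $x\cdot 0=0$; $x\cdot S(y)=x\cdot y+x$; $\lnot x<0$; $x<S(y)\leftrightarrow x<y\lor x=y$; $x<y\lor x=y\lor y<x$; $0<x\to\exists y<x\,S(y)=x$; $(x,y)=z\leftrightarrow 2\cdot z=(x+y)\cdot(x+y+1)+2\cdot x+2$; $(x,y)=(x',y')\to x=x'\land y=y'$; $z>0\to\exists x,y<z\,(x,y)=z$; $H((x,y))=x$; $H(0)=0$; $T((x,y))=y$; $T(0)=0$. **$L_2$ and functions as sets.** $L_2$ is the two-sorted language extending $L_1$ with set variables and atomic formulas $t\in X$. $L_1(X,\vec f)$ is $L_1$ with additional unary predicate symbols ("set constants") $X$ and $f_d$ ($d$ a derivation, below). For a set $f$, $f\in\mathcal F$ abbreviates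 $\forall x\exists y\,(x,y)\in f\land\forall x,y,y'((x,y)\in f\land(x,y')\in f\to y=y')\land 0\notin f$; $f(t)=s$ abbreviates $(t,s)\in f$. **Function operators and classes of algebras.** A function operator $f:=\mathrm{op}(g_1,\dots,g_n)$ ($n\ge 0$) is specified by a formula of $L_2$ with no free number variables and no set quantifiers, containing exactly the set variables $f,g_1,\dots,g_n$, such that for all $X\subseteq\mathbb N$ and $g_1,\dots,g_n\subseteq\mathbb N$ in $\mathcal F$ there is a unique $f\subseteq\mathbb N$ satisfying $f:=\mathrm{op}(g_1,\dots,g_n)$ and $f\in\mathcal F$. The oracle operator $f:=X_\ast$ is $\forall x((x\in X\to f(x)=1)\land(x\notin X\to f(x)=0))$. A class of function algebras $\mathcal A$ is given by a finite tuple of function operators; it is required throughout that this tuple contains the following operators, each the universal closure of the displayed formula: - $f:=\mathrm S$: $f(x)=S(x)$; - $f:=\oplus$: $f(x,y)=x+y\land f(0)=0$; - $f:=\otimes$: $f(x,y)=x\cdot y\land f(0)=0$; - $f:={<_\ast}$: $(x<y\to f(x,y)=1)\land(x\ge y\to f(x,y)=0)\land f(0)=0$; - $f:=\mathrm I$: $f(x)=x$; - $f:=\mathrm D$: $f(0,y,z)=y\land f(S(x),y,z)=z\land f(0)=0\land f(x,0)=0$; - $f:=\mathrm P(g,h)$: $g(x)=v\land h(x)=w\to f(x)=(v,w)$; - $f:=g\circ h$: $h(x)=z\land g(z)=y\to f(x)=y$; - $f:=\mu(g)$: $(f(b,x)=z\to z\le b)\land(f(b,x)=z\land y<b\land g(y,x)=1\to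 z\le y)\land(f(b,x)=z\land z<b\to g(z,x)=1)\land f(0)=0$. **Derivations and $\mathcal A\mathsf{RA}_1$.** Derivations in $\mathcal A$ are the least set of formal terms containing the symbol $X_\ast$ and containing $\mathrm{op}(d_1,\dots,d_n)$ for each $n$-ary operator $\mathrm{op}$ of $\mathcal A$ and derivations $d_1,\dots,d_n$. They are enumerated in a fixed sequence in which $\mathrm{op}(d_1,\dots,d_n)$ is preceded by $d_1,\dots,d_n$, and are identified with their indices in $\mathbb N$; so $\vec f=f_0,f_1,\dots$. $\mathcal A\mathsf{RA}_1$ is the theory in $L_1(X,\vec f)$ consisting of BASIC, the axioms $f_{X_\ast}:=X_\ast$ and $f_{X_\ast}\in\mathcal F$, and for each operator and derivations $d_1,\dots,d_n$ the axioms $f_{\mathrm{op}(d_1,\dots,d_n)}:=\mathrm{op}(f_{d_1},\dots,f_{d_n})$ and $f_{\mathrm{op}(d_1,\dots,d_n)}\in\mathcal F$. **$\mathcal A\mathsf{RA}_2$.** The $L_2$-theory axiomatized by BASIC; for each operator $\mathrm{op}$ of $\mathcal A$, $\forall g_1,\dots,g_n\in\mathcal F\,\exists f\in\mathcal F\;f:=\mathrm{op}(g_1,\dots,g_n)$; the oracle axiom $\forall X\exists f\in\mathcal F\;f:=X_\ast$; and function comprehension $\forall p\,\forall f\in\mathcal F\,\exists X\,\forall x(x\in X\leftrightarrow f(x,p)=1)$. **Lifting.** For $k\in\mathbb N$ let $\Phi_k$ be the set of axioms of $\mathcal A\mathsf{RA}_1$ defining the constants $f_0,\dots,f_{k-1}$,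 i.e. for each $d<k$ the oracle axiom or operator axiom for $f_d$, together with $f_d\in\mathcal F$. For a sentence $\varphi$ of $L_1(X,\vec f)$ let $k=d+1$ for the largest $d$ such that $f_d$ occurs in $\varphi$, and $k=0$ if there is none. Treating the set constants $X,f_0,\dots,f_{k-1}$ as set variables, the lifted form $\varphi{\uparrow}$ is the $L_2$-sentence $\forall X\,\forall f_0\cdots\forall f_{k-1}\bigl(\bigwedge\Phi_k\to\varphi\bigr)$. -}

module Defs where

open import Data.Empty using (⊥)
open import Data.Fin.Base using (Fin; zero; suc; opposite)
open import Data.Bool.Base using (if_then_else_)
open import Data.List.Base using (List; []; _∷_; map; foldr; concatMap; upTo; length; lookup)
open import Data.List.Membership.Propositional using (_∈_)
open import Data.List.Relation.Binary.Subset.Propositional using (_⊆_)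
open import Data.List.Relation.Unary.All using (All)
open import Data.Maybe.Base as Maybe using (Maybe; nothing; just; fromMaybe; maybe′)
open import Data.Nat.Base using (ℕ; zero; suc; _+_; _*_; _<_; _⊔_; _≡ᵇ_)
open import Data.Product.Base using (Σ-syntax; ∃-syntax; _×_; _,_; proj₁; proj₂)
open import Data.Sum.Base using (_⊎_)
open import Data.Vec.Base as Vec using (Vec; []; _∷_; tabulate)
open import Data.Vec.N-ary using (N-ary; _$ⁿ_)
open import Function.Base using (_∘_)
open import Function.Bundles using (_↔_; Inverse)
open import Level using (0ℓ)
open import Relation.Binary.PropositionalEquality.Core using (_≡_)
open import Relation.Nullary.Negation.Core using (¬_)
open import Relation.Unary using (Pred)

------------------------------------------------------------------------
-- Syntax

-- Number variables are de Bruijn indices below n.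

data Term (n : ℕ) : Set where
  var   : Fin n → Term n
  O     : Term n
  S H T : Term n → Term n
  _⊕_   : Term n → Term n → Term n
  _⊗_   : Term n → Term n → Term n
  ⟨_,_⟩ : Term n → Term n → Term n

infixl 9 _⊗_
infixl 8 _⊕_
infix  7 _≐_ _≺_ _∊_
infixr 4 _⇒_

data Language : Set where
  L₁ L₂ : Language

-- A formula whose free set symbols are drawn from C and whose free number
-- variables are indices below n.  Only L₂-formulas may quantify over sets, and
-- under such a quantifier the bound variable is `nothing`.  An element of C
-- serves as a set constant (unary predicate symbol) or as a free set variable,
-- so L₁(X, f⃗) is obtained with C = SetConstant below, and L₂-sentences with
-- C = ⊥.

data Formula (C : Set) (n : ℕ) : Language → Set where
  falsum  : ∀ {ℓ} → Formula C n ℓ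
  _≐_ _≺_ : ∀ {ℓ} → Term n → Term n → Formula C n ℓ
  _∊_     : ∀ {ℓ} → Term n → C → Formula C n ℓ
  _⇒_     : ∀ {ℓ} → Formula C n ℓ → Formula C n ℓ → Formula C n ℓ
  all     : ∀ {ℓ} → Formula C (suc n) ℓ → Formula C n ℓ
  all₂    : Formula (Maybe C) n L₂ → Formula C n L₂

Sentence : Set → Language → Set
Sentence C ℓ = Formula C 0 ℓ

-- The logic is classical, so the other connectives are abbreviations.

module _ {C : Set} {n : ℕ} {ℓ : Language} where

  infix  8 ~_
  infix  7 _≼_ _⟨_⟩≐_
  infixr 6 _∧_
  infixr 5 _∨_
  infix  3 _⇔_

  ~_ : Formula C n ℓ → Formula C n ℓ
  ~ φ = φ ⇒ falsum

  _∧_ _∨_ _⇔_ : Formula C n ℓ → Formula C n ℓ → Formula C n ℓ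
  φ ∧ ψ = ~ (φ ⇒ ~ ψ)
  φ ∨ ψ = ~ φ ⇒ ψ
  φ ⇔ ψ = (φ ⇒ ψ) ∧ (ψ ⇒ φ)

  ex : Formula C (suc n) ℓ → Formula C n ℓ
  ex φ = ~ all (φ ⇒ falsum)

  ⋀ : List (Formula C n ℓ) → Formula C n ℓ
  ⋀ = foldr _∧_ (falsum ⇒ falsum)

  _≼_ : Term n → Term n → Formula C n ℓ
  s ≼ t = s ≺ t ∨ s ≐ t

  -- f(t) = s
  _⟨_⟩≐_ : C → Term n → Term n → Formula C n ℓ
  f ⟨ t ⟩≐ s = ⟨ t , s ⟩ ∊ f

ex₂ : ∀ {C n} → Formula (Maybe C) n L₂ → Formula C n L₂
ex₂ φ = ~ all₂ (~ φ)

𝟏 𝟐 : ∀ {n} → Term n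
𝟏 = S O
𝟐 = S (S O)

------------------------------------------------------------------------
-- Substitution

subₜ : ∀ {m n} → (Fin m → Term n) → Term m → Term n
subₜ σ (var i)   = σ i
subₜ σ O         = O
subₜ σ (S t)     = S (subₜ σ t)
subₜ σ (H t)     = H (subₜ σ t)
subₜ σ (T t)     = T (subₜ σ t)
subₜ σ (s ⊕ t)   = subₜ σ s ⊕ subₜ σ t
subₜ σ (s ⊗ t)   = subₜ σ s ⊗ subₜ σ t
subₜ σ ⟨ s , t ⟩ = ⟨ subₜ σ s , subₜ σ t ⟩

↑_ : ∀ {n} → Term n → Term (suc n)
↑_ = subₜ (var ∘ suc)

lifts : ∀ {m n} → (Fin m → Term n) → Fin (suc m) → Term (suc n)
lifts σ zero    = var zero
lifts σ (suc i) = ↑ σ i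

sub : ∀ {C m n ℓ} → (Fin m → Term n) → Formula C m ℓ → Formula C n ℓ
sub σ falsum   = falsum
sub σ (s ≐ t)  = subₜ σ s ≐ subₜ σ t
sub σ (s ≺ t)  = subₜ σ s ≺ subₜ σ t
sub σ (t ∊ c)  = subₜ σ t ∊ c
sub σ (φ ⇒ ψ)  = sub σ φ ⇒ sub σ ψ
sub σ (all φ)  = all (sub (lifts σ) φ)
sub σ (all₂ φ) = all₂ (sub σ φ)

weaken : ∀ {C n ℓ} → Formula C n ℓ → Formula C (suc n) ℓ
weaken = sub (var ∘ suc)

_[_] : ∀ {C n ℓ} → Formula C (suc n) ℓ → Term n → Formula C n ℓ
φ [ t ] = sub (λ { zero → t ; (suc i) → var i }) φ

mapSets : ∀ {C D n ℓ} → (C → D) → Formula C n ℓ → Formula D n ℓ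
mapSets ρ falsum   = falsum
mapSets ρ (s ≐ t)  = s ≐ t
mapSets ρ (s ≺ t)  = s ≺ t
mapSets ρ (t ∊ c)  = t ∊ ρ c
mapSets ρ (φ ⇒ ψ)  = mapSets ρ φ ⇒ mapSets ρ ψ
mapSets ρ (all φ)  = all (mapSets ρ φ)
mapSets ρ (all₂ φ) = all₂ (mapSets (Maybe.map ρ) φ)

weaken₂ : ∀ {C n ℓ} → Formula C n ℓ → Formula (Maybe C) n ℓ
weaken₂ = mapSets just

_[_]₂ : ∀ {C n ℓ} → Formula (Maybe C) n ℓ → C → Formula C n ℓ
φ [ c ]₂ = mapSets (fromMaybe c) φ

embed : ∀ {C n} → Formula C n L₁ → Formula C n L₂
embed falsum  = falsum
embed (s ≐ t) = s ≐ t
embed (s ≺ t) = s ≺ t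
embed (t ∊ c) = t ∊ c
embed (φ ⇒ ψ) = embed φ ⇒ embed ψ
embed (all φ) = all (embed φ)

------------------------------------------------------------------------
-- Classical natural deduction with equality, one-sorted for L₁ and two-sorted
-- for L₂

infix 2 _⊢_ _⊩_

data _⊢_ {C : Set} {n : ℕ} : ∀ {ℓ} → List (Formula C n ℓ) → Formula C n ℓ → Set where
  hyp       : ∀ {ℓ} {Γ : List (Formula C n ℓ)} {φ} → φ ∈ Γ → Γ ⊢ φ
  ⇒-intro   : ∀ {ℓ} {Γ : List (Formula C n ℓ)} {φ ψ} → φ ∷ Γ ⊢ ψ → Γ ⊢ φ ⇒ ψ
  ⇒-elim    : ∀ {ℓ} {Γ : List (Formula C n ℓ)} {φ ψ} → Γ ⊢ φ ⇒ ψ → Γ ⊢ φ → Γ ⊢ ψ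
  raa       : ∀ {ℓ} {Γ : List (Formula C n ℓ)} {φ} → ~ φ ∷ Γ ⊢ falsum → Γ ⊢ φ
  all-intro : ∀ {ℓ} {Γ : List (Formula C n ℓ)} {φ} → map weaken Γ ⊢ φ → Γ ⊢ all φ
  all-elim  : ∀ {ℓ} {Γ : List (Formula C n ℓ)} {φ} → Γ ⊢ all φ → ∀ t → Γ ⊢ φ [ t ]
  all₂-intro : {Γ : List (Formula C n L₂)} {φ : Formula (Maybe C) n L₂} →
               map weaken₂ Γ ⊢ φ → Γ ⊢ all₂ φ
  all₂-elim  : {Γ : List (Formula C n L₂)} {φ : Formula (Maybe C) n L₂} →
               Γ ⊢ all₂ φ → ∀ c → Γ ⊢ φ [ c ]₂
  ≐-refl    : ∀ {ℓ} {Γ : List (Formula C n ℓ)} t → Γ ⊢ t ≐ t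
  ≐-subst   : ∀ {ℓ} {Γ : List (Formula C n ℓ)} (φ : Formula C (suc n) ℓ) {s t} →
              Γ ⊢ s ≐ t → Γ ⊢ φ [ s ] → Γ ⊢ φ [ t ]

Theory : Set → Language → Set₁
Theory C ℓ = Pred (Sentence C ℓ) 0ℓ

_⊩_ : ∀ {C ℓ} → Theory C ℓ → Sentence C ℓ → Set
_⊩_ {C} {ℓ} 𝒯 φ = Σ[ Γ ∈ List (Sentence C ℓ) ] (All 𝒯 Γ × (Γ ⊢ φ))

------------------------------------------------------------------------
-- BASIC

all* : ∀ {C ℓ} n → Formula C n ℓ → Sentence C ℓ
all* zero    φ = φ
all* (suc n) φ = all* n (all φ)

-- closure n λ x₁ … xₙ → φ  is  ∀x₁ … ∀xₙ φ.
closure : ∀ {C ℓ} n → N-ary n (Term n) (Formula C n ℓ) → Sentence C ℓ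
closure n φ = all* n (φ $ⁿ tabulate (var ∘ opposite))

-- ∃y<t φ, with y the variable 0 of φ.
ex< : ∀ {C n ℓ} → Term n → Formula C (suc n) ℓ → Formula C n ℓ
ex< t φ = ex (var zero ≺ ↑ t ∧ φ)

BASIC : ∀ {C ℓ} → List (Sentence C ℓ)
BASIC =
    closure 1 (λ x → ~ (S x ≐ O))
  ∷ closure 2 (λ x y → S x ≐ S y ⇒ x ≐ y)
  ∷ closure 1 (λ x → x ⊕ O ≐ x)
  ∷ closure 2 (λ x y → x ⊕ S y ≐ S (x ⊕ y))
  ∷ closure 1 (λ x → x ⊗ O ≐ O)
  ∷ closure 2 (λ x y → x ⊗ S y ≐ x ⊗ y ⊕ x)
  ∷ closure 1 (λ x → ~ (x ≺ O))
  ∷ closure 2 (λ x y → x ≺ S y ⇔ x ≺ y ∨ x ≐ y)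
  ∷ closure 2 (λ x y → x ≺ y ∨ x ≐ y ∨ y ≺ x)
  ∷ closure 1 (λ x → O ≺ x ⇒ ex< x (S (var zero) ≐ ↑ x))
  ∷ closure 3 (λ x y z →
      ⟨ x , y ⟩ ≐ z ⇔ 𝟐 ⊗ z ≐ (x ⊕ y) ⊗ (x ⊕ y ⊕ 𝟏) ⊕ 𝟐 ⊗ x ⊕ 𝟐)
  ∷ closure 4 (λ x y x′ y′ → ⟨ x , y ⟩ ≐ ⟨ x′ , y′ ⟩ ⇒ x ≐ x′ ∧ y ≐ y′)
  ∷ closure 1 (λ z → O ≺ z ⇒
      ex< z (ex< (↑ z) (⟨ var (suc zero) , var zero ⟩ ≐ ↑ ↑ z)))
  ∷ closure 2 (λ x y → H ⟨ x , y ⟩ ≐ x)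
  ∷ H O ≐ O
  ∷ closure 2 (λ x y → T ⟨ x , y ⟩ ≐ y)
  ∷ T O ≐ O
  ∷ []

------------------------------------------------------------------------
-- Functions as sets

-- f ∈ 𝓕
isFunction : ∀ {C n ℓ} → C → Formula C n ℓ
isFunction f =
    all (ex (f ⟨ x₁ ⟩≐ x₀))
  ∧ all (all (all (f ⟨ x₂ ⟩≐ x₁ ∧ f ⟨ x₂ ⟩≐ x₀ ⇒ x₁ ≐ x₀)))
  ∧ ~ (O ∊ f)
  where
  x₀ : ∀ {n} → Term (suc n)
  x₀ = var zero
  x₁ : ∀ {n} → Term (suc (suc n))
  x₁ = var (suc zero)
  x₂ : ∀ {n} → Term (suc (suc (suc n)))
  x₂ = var (suc (suc zero))

SetVars : ℕ → Set
SetVars zero    = ⊥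
SetVars (suc n) = Maybe (SetVars n)

assign : ∀ {n} {D : Set} → Vec D n → SetVars n → D
assign (d ∷ ds) nothing  = d
assign (d ∷ ds) (just v) = assign ds v

-- f:=op(g₁,…,gₙ) as a formula without set quantifiers: the variables
-- f, g₁, …, gₙ are nothing, just nothing, just (just nothing), …
OperatorFormula : ℕ → Set
OperatorFormula n = Sentence (SetVars (suc n)) L₁

pattern 𝐟 = nothing
pattern 𝐠 = just nothing
pattern 𝐡 = just (just nothing)

-- f:=X∗, with X in the position of an argument.
oracle : OperatorFormula 1
oracle = closure 1 λ x → (x ∊ 𝐠 ⇒ 𝐟 ⟨ x ⟩≐ 𝟏) ∧ (~ (x ∊ 𝐠) ⇒ 𝐟 ⟨ x ⟩≐ O)

baseOperators : List (Σ[ n ∈ ℕ ] OperatorFormula n)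
baseOperators =
    (0 , closure 1 λ x → 𝐟 ⟨ x ⟩≐ S x)
  ∷ (0 , closure 2 λ x y → 𝐟 ⟨ ⟨ x , y ⟩ ⟩≐ x ⊕ y ∧ 𝐟 ⟨ O ⟩≐ O)
  ∷ (0 , closure 2 λ x y → 𝐟 ⟨ ⟨ x , y ⟩ ⟩≐ x ⊗ y ∧ 𝐟 ⟨ O ⟩≐ O)
  ∷ (0 , closure 2 λ x y →
        (x ≺ y ⇒ 𝐟 ⟨ ⟨ x , y ⟩ ⟩≐ 𝟏)
      ∧ (y ≼ x ⇒ 𝐟 ⟨ ⟨ x , y ⟩ ⟩≐ O)
      ∧ 𝐟 ⟨ O ⟩≐ O)
  ∷ (0 , closure 1 λ x → 𝐟 ⟨ x ⟩≐ x)
  ∷ (0 , closure 3 λ x y z →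
        𝐟 ⟨ ⟨ O , ⟨ y , z ⟩ ⟩ ⟩≐ y
      ∧ 𝐟 ⟨ ⟨ S x , ⟨ y , z ⟩ ⟩ ⟩≐ z
      ∧ 𝐟 ⟨ O ⟩≐ O
      ∧ 𝐟 ⟨ ⟨ x , O ⟩ ⟩≐ O)
  ∷ (2 , closure 3 λ x v w →
        𝐠 ⟨ x ⟩≐ v ∧ 𝐡 ⟨ x ⟩≐ w ⇒ 𝐟 ⟨ x ⟩≐ ⟨ v , w ⟩)
  ∷ (2 , closure 3 λ x y z →
        𝐡 ⟨ x ⟩≐ z ∧ 𝐠 ⟨ z ⟩≐ y ⇒ 𝐟 ⟨ x ⟩≐ y)
  ∷ (1 , closure 4 λ b x y z →
        (𝐟 ⟨ ⟨ b , x ⟩ ⟩≐ z ⇒ z ≼ b)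
      ∧ (𝐟 ⟨ ⟨ b , x ⟩ ⟩≐ z ∧ y ≺ b ∧ 𝐠 ⟨ ⟨ y , x ⟩ ⟩≐ 𝟏 ⇒ z ≼ y)
      ∧ (𝐟 ⟨ ⟨ b , x ⟩ ⟩≐ z ∧ z ≺ b ⇒ 𝐠 ⟨ ⟨ z , x ⟩ ⟩≐ 𝟏)
      ∧ 𝐟 ⟨ O ⟩≐ O)
  ∷ []

------------------------------------------------------------------------
-- The standard model

-- The number of pairs of sum below s.
triangle : ℕ → ℕ
triangle zero    = zero
triangle (suc s) = triangle s + suc s

pair : ℕ → ℕ → ℕ
pair x y = suc (triangle (x + y) + x)

-- The inverse of pair, walking along each diagonal x + y = s in turn.
unpair : ℕ → ℕ × ℕ
unpair zero          = 0 , 0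
unpair (suc zero)    = 0 , 0
unpair (suc (suc z)) = next (unpair (suc z))
  where
  next : ℕ × ℕ → ℕ × ℕ
  next (x , zero)  = zero , suc x
  next (x , suc y) = suc x , y

eval : ∀ {n} → Vec ℕ n → Term n → ℕ
eval ρ (var i)   = Vec.lookup ρ i
eval ρ O         = 0
eval ρ (S t)     = suc (eval ρ t)
eval ρ (H t)     = proj₁ (unpair (eval ρ t))
eval ρ (T t)     = proj₂ (unpair (eval ρ t))
eval ρ (s ⊕ t)   = eval ρ s + eval ρ t
eval ρ (s ⊗ t)   = eval ρ s * eval ρ t
eval ρ ⟨ s , t ⟩ = pair (eval ρ s) (eval ρ t)

infix 2 _,_⊨_

-- Classical truth: with membership read under ¬ ¬, the truth of every formula is
-- ¬ ¬-stable, and the defined connectives obey the laws of classical logic.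
_,_⊨_ : ∀ {C n} → (C → Pred ℕ 0ℓ) → Vec ℕ n → Formula C n L₁ → Set
𝓘 , ρ ⊨ falsum  = ⊥
𝓘 , ρ ⊨ s ≐ t   = eval ρ s ≡ eval ρ t
𝓘 , ρ ⊨ s ≺ t   = eval ρ s < eval ρ t
𝓘 , ρ ⊨ t ∊ c   = ¬ ¬ 𝓘 c (eval ρ t)
𝓘 , ρ ⊨ φ ⇒ ψ   = 𝓘 , ρ ⊨ φ → 𝓘 , ρ ⊨ ψ
𝓘 , ρ ⊨ all φ   = ∀ a → 𝓘 , a ∷ ρ ⊨ φ

------------------------------------------------------------------------
-- Function operators and classes of function algebras

Occurs : ∀ {C n} → C → Formula C n L₁ → Set
Occurs c falsum  = ⊥
Occurs c (s ≐ t) = ⊥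
Occurs c (s ≺ t) = ⊥
Occurs c (t ∊ d) = c ≡ d
Occurs c (φ ⇒ ψ) = Occurs c φ ⊎ Occurs c ψ
Occurs c (all φ) = Occurs c φ

record FunctionOperator : Set₁ where
  field
    arity   : ℕ
    formula : OperatorFormula arity
    occurs  : ∀ v → Occurs v formula

  -- f is a value of the operator at g: f:=op(g₁,…,gₙ) and f ∈ 𝓕.
  IsValue : (SetVars arity → Pred ℕ 0ℓ) → Pred ℕ 0ℓ → Set
  IsValue g f = (maybe′ g f , [] ⊨ formula) × (maybe′ g f , [] ⊨ isFunction 𝐟)

  field
    exists : ∀ g → (∀ i → g , [] ⊨ isFunction i) → ¬ ¬ (∃[ f ] IsValue g f)
    unique : ∀ g → (∀ i → g , [] ⊨ isFunction i) →
             ∀ f f′ → IsValue g f → IsValue g f′ → ∀ z → ¬ ¬ f z → ¬ ¬ f′ z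

  specification : Σ[ n ∈ ℕ ] OperatorFormula n
  specification = arity , formula

open FunctionOperator using (arity; formula; specification)

record FunctionAlgebraClass : Set₁ where
  field
    operators : List FunctionOperator
    contains  : baseOperators ⊆ map specification operators

  operator : Fin (length operators) → FunctionOperator
  operator = lookup operators

open FunctionAlgebraClass using (operators; operator)

------------------------------------------------------------------------
-- Derivations

-- op i is the symbol of the i-th operator in the tuple.
data Derivation (𝓐 : FunctionAlgebraClass) : Set where
  X∗ : Derivation 𝓐
  op : ∀ i → Vec (Derivation 𝓐) (arity (operator 𝓐 i)) → Derivation 𝓐

record Enumeration (𝓐 : FunctionAlgebraClass) : Set where
  field
    enumeration : ℕ ↔ Derivation 𝓐

  derivation : ℕ → Derivation 𝓐
  derivation = Inverse.to enumeration

  index : Derivation 𝓐 → ℕ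
  index = Inverse.from enumeration

  field
    precedes : ∀ i ds j → index (Vec.lookup ds j) < index (op i ds)

------------------------------------------------------------------------
-- 𝓐RA₁

data SetConstant : Set where
  X  : SetConstant
  fₛ : ℕ → SetConstant

module _ (𝓐 : FunctionAlgebraClass) (𝓔 : Enumeration 𝓐) where

  open Enumeration 𝓔

  defining : SetConstant → Derivation 𝓐 → Sentence SetConstant L₁
  defining f X∗        = mapSets (assign (f ∷ X ∷ [])) oracle
  defining f (op i ds) =
    mapSets (assign (f ∷ Vec.map (fₛ ∘ index) ds)) (formula (operator 𝓐 i))

  data ARA₁ : Theory SetConstant L₁ where
    basic       : ∀ {φ} → φ ∈ BASIC → ARA₁ φ
    definition  : ∀ d → ARA₁ (defining (fₛ d) (derivation d))
    functional  : ∀ d → ARA₁ (isFunction (fₛ d))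

  Φ : ℕ → List (Sentence SetConstant L₁)
  Φ k = concatMap (λ d → defining (fₛ d) (derivation d) ∷ isFunction (fₛ d) ∷ []) (upTo k)

------------------------------------------------------------------------
-- 𝓐RA₂

all₂* : ∀ {n} k → Formula (SetVars k) n L₂ → Formula ⊥ n L₂
all₂* zero    φ = φ
all₂* (suc k) φ = all₂* k (all₂ φ)

all∈𝓕* : ∀ {n} k → Formula (SetVars k) n L₂ → Formula ⊥ n L₂
all∈𝓕* zero    φ = φ
all∈𝓕* (suc k) φ = all∈𝓕* k (all₂ (isFunction nothing ⇒ φ))

ex∈𝓕 : ∀ {C n} → Formula (Maybe C) n L₂ → Formula C n L₂
ex∈𝓕 φ = ex₂ (isFunction nothing ∧ φ)

-- ∀gₙ∈𝓕 … ∀g₁∈𝓕 ∃f∈𝓕 f:=op(g₁,…,gₙ), f being the innermost bound variable.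
operatorAxiom : FunctionOperator → Sentence ⊥ L₂
operatorAxiom o = all∈𝓕* (arity o) (ex∈𝓕 (embed (formula o)))

oracleAxiom : Sentence ⊥ L₂
oracleAxiom = all₂* 1 (ex∈𝓕 (embed oracle))

-- ∀p ∀f∈𝓕 ∃X ∀x (x ∈ X ↔ f(x,p) = 1): inside, x and p are the number variables
-- 0 and 1, X and f the set variables nothing and just nothing.
comprehension : Sentence ⊥ L₂
comprehension =
  all (all∈𝓕* 1 (ex₂ (all
    (var zero ∊ nothing ⇔ just nothing ⟨ ⟨ var zero , var (suc zero) ⟩ ⟩≐ 𝟏))))

data ARA₂ (𝓐 : FunctionAlgebraClass) : Theory ⊥ L₂ where
  basic       : ∀ {φ} → φ ∈ BASIC → ARA₂ 𝓐 φ
  operatorAx  : ∀ i → ARA₂ 𝓐 (operatorAxiom (operator 𝓐 i))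
  oracleAx    : ARA₂ 𝓐 oracleAxiom
  comprehend  : ARA₂ 𝓐 comprehension

------------------------------------------------------------------------
-- Lifting

-- d + 1 for the largest d such that f_d occurs, 0 if there is none.
constantBound : ∀ {n} → Formula SetConstant n L₁ → ℕ
constantBound falsum       = 0
constantBound (s ≐ t)      = 0
constantBound (s ≺ t)      = 0
constantBound (t ∊ X)      = 0
constantBound (t ∊ fₛ d)   = suc d
constantBound (φ ⇒ ψ)      = constantBound φ ⊔ constantBound ψ
constantBound (all φ)      = constantBound φ

-- The set variable bound in the prefix ∀X ∀f₀ … ∀f_{k-1} for a constant among
-- X, f₀, …, f_{k-1}.  Other constants, which do not occur in Φ k nor in the
-- formula to be lifted, are sent to X as well.
toVariable : ∀ k → SetConstant → SetVars (suc k)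
toVariable zero    c      = nothing
toVariable (suc k) X      = just (toVariable k X)
toVariable (suc k) (fₛ d) = if d ≡ᵇ k then nothing else just (toVariable k (fₛ d))

module _ (𝓐 : FunctionAlgebraClass) (𝓔 : Enumeration 𝓐) where

  lifted : Sentence SetConstant L₁ → Sentence ⊥ L₂
  lifted φ = all₂* (suc k) (embed (mapSets (toVariable k) (⋀ (Φ 𝓐 𝓔 k) ⇒ φ)))
    where
    k : ℕ
    k = constantBound φ

{-# OPTIONS --safe #-}
module Submission where

-- The theorem is a proof transformation.  A derivation of φ in 𝓐RA₁ uses
-- finitely many axioms, hence only the definitions of f₀, …, f_{K-1} for some
-- K, which may be taken to be at least the bound k of the constants in φ itself.
-- Reading set constants as set variables turns it, rule by rule, into an
-- L₂-derivation of φ from BASIC and Φ K (translate-⊢, axiom-translates).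
--
-- The superfluous variables f_{K-1}, …, f_k are then removed in this order,
-- the latest first (eliminate).  At that moment f_j occurs only in its own
-- defining axioms: φ and the axioms for earlier constants do not mention it.
-- As the enumeration lists the arguments of an operator before its value, f_j
-- is defined from earlier constants, which Φ j declares to be functions.  The
-- operator axiom (or the oracle axiom) of 𝓐RA₂ therefore proves from Φ j that
-- a suitable f_j exists (value-exists), and existential elimination discharges
-- the two axioms for f_j.
--
-- What remains is a derivation of φ from Φ k and sentences of 𝓐RA₂.
-- Discharging the conjunction of Φ k and generalising over the set variables
-- gives the lifted form of φ; the generalisation is allowed because sentences
-- of 𝓐RA₂ have no free set variables (all₂*-intro).

open import Data.Bool.Base using (true; false; if_then_else_)
open import Data.Empty using (⊥)
open import Data.Fin.Base using (Fin; zero; suc)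
open import Data.List.Base as List using (List; []; _∷_; _++_; map)
open import Data.List.Membership.Propositional using (_∈_; lose)
open import Data.List.Membership.Propositional.Properties
  using (∈-map⁺; ∈-++⁺ˡ; ∈-++⁺ʳ; ∈-concatMap⁺; ∈-upTo⁺; ∈-tabulate⁺)
import Data.List.Properties as List
open import Data.List.Relation.Binary.Subset.Propositional using (_⊆_)
open import Data.List.Relation.Binary.Subset.Propositional.Properties using (∷⁺ʳ; map⁺; xs⊆xs++ys)
open import Data.List.Relation.Unary.All as All using (All; []; _∷_)
import Data.List.Relation.Unary.All.Properties as All
open import Data.List.Relation.Unary.Any using (here; there)
open import Data.Maybe.Base as Maybe using (Maybe; nothing; just)
open import Data.Maybe.Properties using (map-id; map-∘; map-cong)
open import Data.Nat.Base using (ℕ; zero; suc; _+_; _≤_; _<_; _⊔_; _≡ᵇ_; z≤n; s≤s)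
open import Data.Nat.Properties
  using (≤-refl; ≤-trans; m≤n⇒m≤1+n; ⊔-lub; m⊔n≤o⇒m≤o; m⊔n≤o⇒n≤o;
         m≤m+n; m≤n+m; m<1+n⇒m<n∨m≡n)
open import Data.Product.Base using (∃-syntax; _,_; proj₁; proj₂)
open import Data.Sum.Base using (inj₁; inj₂)
open import Data.Vec.Base as Vec using (Vec; []; _∷_)
open import Data.Vec.Properties using (lookup-map)
open import Data.Vec.Relation.Unary.All as VecAll using ([]; _∷_)
import Data.Vec.Relation.Unary.All.Properties as VecAll
open import Function.Base using (_∘_; id)
open import Function.Bundles using (Inverse)
open import Relation.Binary.PropositionalEquality
  using (_≡_; _≗_; refl; sym; trans; cong; cong₂; subst; module ≡-Reasoning)

open import Defs

open FunctionOperator using (arity; formula)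
open FunctionAlgebraClass using (operator)

-- Renaming set symbols

mapSets-cong : ∀ {C D n ℓ} {ρ ρ′ : C → D} → ρ ≗ ρ′ →
               (φ : Formula C n ℓ) → mapSets ρ φ ≡ mapSets ρ′ φ
mapSets-cong eq falsum   = refl
mapSets-cong eq (s ≐ t)  = refl
mapSets-cong eq (s ≺ t)  = refl
mapSets-cong eq (t ∊ c)  = cong (t ∊_) (eq c)
mapSets-cong eq (φ ⇒ ψ)  = cong₂ _⇒_ (mapSets-cong eq φ) (mapSets-cong eq ψ)
mapSets-cong eq (all φ)  = cong all (mapSets-cong eq φ)
mapSets-cong eq (all₂ φ) = cong all₂ (mapSets-cong (map-cong eq) φ)

mapSets-id : ∀ {C n ℓ} {ρ : C → C} → ρ ≗ id → (φ : Formula C n ℓ) → mapSets ρ φ ≡ φ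
mapSets-id eq falsum   = refl
mapSets-id eq (s ≐ t)  = refl
mapSets-id eq (s ≺ t)  = refl
mapSets-id eq (t ∊ c)  = cong (t ∊_) (eq c)
mapSets-id eq (φ ⇒ ψ)  = cong₂ _⇒_ (mapSets-id eq φ) (mapSets-id eq ψ)
mapSets-id eq (all φ)  = cong all (mapSets-id eq φ)
mapSets-id eq (all₂ φ) =
  cong all₂ (mapSets-id (λ c → trans (map-cong eq c) (map-id c)) φ)

mapSets-∘ : ∀ {C D E n ℓ} (ρ′ : D → E) (ρ : C → D) (φ : Formula C n ℓ) →
            mapSets ρ′ (mapSets ρ φ) ≡ mapSets (ρ′ ∘ ρ) φ
mapSets-∘ ρ′ ρ falsum   = refl
mapSets-∘ ρ′ ρ (s ≐ t)  = refl
mapSets-∘ ρ′ ρ (s ≺ t)  = refl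
mapSets-∘ ρ′ ρ (t ∊ c)  = refl
mapSets-∘ ρ′ ρ (φ ⇒ ψ)  = cong₂ _⇒_ (mapSets-∘ ρ′ ρ φ) (mapSets-∘ ρ′ ρ ψ)
mapSets-∘ ρ′ ρ (all φ)  = cong all (mapSets-∘ ρ′ ρ φ)
mapSets-∘ ρ′ ρ (all₂ φ) = cong all₂ (trans (mapSets-∘ (Maybe.map ρ′) (Maybe.map ρ) φ)
                                           (mapSets-cong (sym ∘ map-∘) φ))

mapSets-fuse : ∀ {C D E n ℓ} {ρ′ : D → E} {ρ : C → D} {π : C → E} → ρ′ ∘ ρ ≗ π →
               (φ : Formula C n ℓ) → mapSets ρ′ (mapSets ρ φ) ≡ mapSets π φ
mapSets-fuse {ρ′ = ρ′} {ρ} eq φ = trans (mapSets-∘ ρ′ ρ φ) (mapSets-cong eq φ)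

-- Reading an L₁-formula in L₂, its set constants becoming set variables.
translate : ∀ {C D n} → (C → D) → Formula C n L₁ → Formula D n L₂
translate ρ φ = embed (mapSets ρ φ)

mapSets-embed : ∀ {C D n} (ρ : C → D) (φ : Formula C n L₁) →
                mapSets ρ (embed φ) ≡ translate ρ φ
mapSets-embed ρ falsum  = refl
mapSets-embed ρ (s ≐ t) = refl
mapSets-embed ρ (s ≺ t) = refl
mapSets-embed ρ (t ∊ c) = refl
mapSets-embed ρ (φ ⇒ ψ) = cong₂ _⇒_ (mapSets-embed ρ φ) (mapSets-embed ρ ψ)
mapSets-embed ρ (all φ) = cong all (mapSets-embed ρ φ)

-- Stated for two pointwise equal substitutions because the substitution inside
-- φ [ t ] is an anonymous function depending on φ, so that those for φ and for
-- its translation agree only pointwise.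
translate-sub : ∀ {C D m n} (ρ : C → D) {σ σ′ : Fin m → Term n} → σ ≗ σ′ →
                (φ : Formula C m L₁) →
                translate ρ (sub σ φ) ≡ sub σ′ (translate ρ φ)
translate-sub ρ {σ} {σ′} eq = go eq
  where
  subₜ-cong : ∀ {m n} {σ σ′ : Fin m → Term n} → σ ≗ σ′ → subₜ σ ≗ subₜ σ′
  subₜ-cong eq (var i)   = eq i
  subₜ-cong eq O         = refl
  subₜ-cong eq (S t)     = cong S (subₜ-cong eq t)
  subₜ-cong eq (H t)     = cong H (subₜ-cong eq t)
  subₜ-cong eq (T t)     = cong T (subₜ-cong eq t)
  subₜ-cong eq (s ⊕ t)   = cong₂ _⊕_ (subₜ-cong eq s) (subₜ-cong eq t)
  subₜ-cong eq (s ⊗ t)   = cong₂ _⊗_ (subₜ-cong eq s) (subₜ-cong eq t)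
  subₜ-cong eq ⟨ s , t ⟩ = cong₂ ⟨_,_⟩ (subₜ-cong eq s) (subₜ-cong eq t)

  lifts-cong : ∀ {m n} {σ σ′ : Fin m → Term n} → σ ≗ σ′ → lifts σ ≗ lifts σ′
  lifts-cong eq zero    = refl
  lifts-cong eq (suc i) = cong ↑_ (eq i)

  go : ∀ {m n} {σ σ′ : Fin m → Term n} → σ ≗ σ′ → ∀ φ →
       translate ρ (sub σ φ) ≡ sub σ′ (translate ρ φ)
  go eq falsum  = refl
  go eq (s ≐ t) = cong₂ _≐_ (subₜ-cong eq s) (subₜ-cong eq t)
  go eq (s ≺ t) = cong₂ _≺_ (subₜ-cong eq s) (subₜ-cong eq t)
  go eq (t ∊ c) = cong (_∊ ρ c) (subₜ-cong eq t)
  go eq (φ ⇒ ψ) = cong₂ _⇒_ (go eq φ) (go eq ψ)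
  go eq (all φ) = cong all (go (lifts-cong eq) φ)

translate-weaken : ∀ {C D n} (ρ : C → D) (φ : Formula C n L₁) →
                   translate ρ (weaken φ) ≡ weaken (translate ρ φ)
translate-weaken ρ = translate-sub ρ (λ _ → refl)

translate-[] : ∀ {C D n} (ρ : C → D) (φ : Formula C (suc n) L₁) t →
               translate ρ (φ [ t ]) ≡ translate ρ φ [ t ]
translate-[] ρ φ t = translate-sub ρ (λ { zero → refl ; (suc i) → refl }) φ

-- Derived rules

weakening : ∀ {C n ℓ} {Γ Δ : List (Formula C n ℓ)} {φ} → Γ ⊆ Δ → Γ ⊢ φ → Δ ⊢ φ
weakening Γ⊆Δ (hyp φ∈Γ)         = hyp (Γ⊆Δ φ∈Γ)
weakening Γ⊆Δ (⇒-intro d)       = ⇒-intro (weakening (∷⁺ʳ _ Γ⊆Δ) d)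
weakening Γ⊆Δ (⇒-elim d e)      = ⇒-elim (weakening Γ⊆Δ d) (weakening Γ⊆Δ e)
weakening Γ⊆Δ (raa d)           = raa (weakening (∷⁺ʳ _ Γ⊆Δ) d)
weakening Γ⊆Δ (all-intro d)     = all-intro (weakening (map⁺ weaken Γ⊆Δ) d)
weakening Γ⊆Δ (all-elim d t)    = all-elim (weakening Γ⊆Δ d) t
weakening Γ⊆Δ (all₂-intro d)    = all₂-intro (weakening (map⁺ weaken₂ Γ⊆Δ) d)
weakening Γ⊆Δ (all₂-elim d c)   = all₂-elim (weakening Γ⊆Δ d) c
weakening Γ⊆Δ (≐-refl t)        = ≐-refl t
weakening Γ⊆Δ (≐-subst φ d e)   = ≐-subst φ (weakening Γ⊆Δ d) (weakening Γ⊆Δ e)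

-- A derivation can be translated rule by rule, since translation commutes with
-- the two substitutions that occur in the quantifier and equality rules.
translate-⊢ : ∀ {C D n} (ρ : C → D) {Γ : List (Formula C n L₁)} {φ} →
              Γ ⊢ φ → map (translate ρ) Γ ⊢ translate ρ φ
translate-⊢ ρ (hyp φ∈Γ)      = hyp (∈-map⁺ (translate ρ) φ∈Γ)
translate-⊢ ρ (⇒-intro d)    = ⇒-intro (translate-⊢ ρ d)
translate-⊢ ρ (⇒-elim d e)   = ⇒-elim (translate-⊢ ρ d) (translate-⊢ ρ e)
translate-⊢ ρ (raa d)        = raa (translate-⊢ ρ d)
translate-⊢ ρ {Γ} (all-intro {φ = φ} d) =
  all-intro (subst (_⊢ translate ρ φ) commute (translate-⊢ ρ d))
  where
  open ≡-Reasoning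
  commute : map (translate ρ) (map weaken Γ) ≡ map weaken (map (translate ρ) Γ)
  commute = begin
    map (translate ρ) (map weaken Γ)  ≡⟨ List.map-∘ Γ ⟨
    map (translate ρ ∘ weaken) Γ      ≡⟨ List.map-cong (translate-weaken ρ) Γ ⟩
    map (weaken ∘ translate ρ) Γ      ≡⟨ List.map-∘ Γ ⟩
    map weaken (map (translate ρ) Γ)  ∎
translate-⊢ ρ {Γ} (all-elim {φ = φ} d t) =
  subst (_ ⊢_) (sym (translate-[] ρ φ t)) (all-elim (translate-⊢ ρ d) t)
translate-⊢ ρ (≐-refl t)     = ≐-refl t
translate-⊢ ρ (≐-subst φ {s} {t} d e) =
  subst (_ ⊢_) (sym (translate-[] ρ φ t))
    (≐-subst (translate ρ φ) (translate-⊢ ρ d)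
      (subst (_ ⊢_) (translate-[] ρ φ s) (translate-⊢ ρ e)))

module _ {C : Set} {n : ℕ} {ℓ : Language} where

  -- The hypotheses are discharged by implications, as rules that extend the
  -- context with weakened formulas make a direct induction awkward.
  cut : ∀ {Γ Δ : List (Formula C n ℓ)} {φ} → All (Γ ⊢_) Δ → Δ ⊢ φ → Γ ⊢ φ
  cut []       d = weakening (λ ()) d
  cut (e ∷ es) d = ⇒-elim (cut es (⇒-intro d)) e

  ∧-intro : ∀ {Γ : List (Formula C n ℓ)} {φ ψ} → Γ ⊢ φ → Γ ⊢ ψ → Γ ⊢ φ ∧ ψ
  ∧-intro d e = ⇒-intro (⇒-elim (⇒-elim (hyp (here refl)) (weakening there d))
                                (weakening there e))

  ∧-elimˡ : ∀ {Γ : List (Formula C n ℓ)} {φ ψ} → Γ ⊢ φ ∧ ψ → Γ ⊢ φ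
  ∧-elimˡ d = raa (⇒-elim (weakening there d)
    (⇒-intro (⇒-intro (⇒-elim (hyp (there (there (here refl))))
                              (hyp (there (here refl)))))))

  ∧-elimʳ : ∀ {Γ : List (Formula C n ℓ)} {φ ψ} → Γ ⊢ φ ∧ ψ → Γ ⊢ ψ
  ∧-elimʳ d = raa (⇒-elim (weakening there d) (⇒-intro (hyp (there (here refl)))))

  ⋀-elim : ∀ {Γ : List (Formula C n ℓ)} φs → Γ ⊢ ⋀ φs → All (Γ ⊢_) φs
  ⋀-elim []       d = []
  ⋀-elim (φ ∷ φs) d = ∧-elimˡ d ∷ ⋀-elim φs (∧-elimʳ d)

-- An existential is a negated universal, so χ is proved by contradiction: under
-- ~ χ, the second premise refutes every instance of ψ.
ex₂-elim : ∀ {C n} {Γ : List (Formula C n L₂)} {ψ χ} →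
           Γ ⊢ ex₂ ψ → ψ ∷ map weaken₂ Γ ⊢ weaken₂ χ → Γ ⊢ χ
ex₂-elim d e = raa (⇒-elim (weakening there d)
  (all₂-intro (⇒-intro (⇒-elim (hyp (there (here refl)))
                               (weakening (∷⁺ʳ _ there) e)))))

translate-⋀ : ∀ {C D n} (ρ : C → D) (φs : List (Formula C n L₁)) →
              translate ρ (⋀ φs) ≡ ⋀ (map (translate ρ) φs)
translate-⋀ ρ []       = refl
translate-⋀ ρ (φ ∷ φs) = cong (translate ρ φ ∧_) (translate-⋀ ρ φs)

-- Prefixes of set quantifiers

-- A formula without free set variables, regarded as one in which the set
-- variables D are available.
relax : ∀ {D n} → Formula ⊥ n L₂ → Formula D n L₂
relax = mapSets (assign {0} [])

weaken₂-relax : ∀ {D n} (φ : Formula ⊥ n L₂) → weaken₂ (relax {D} φ) ≡ relax φ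
weaken₂-relax = mapSets-fuse λ ()

-- A prefix of set quantifiers is instantiated from the outside in; this composes
-- the substitution for the outer variables with that for the next one.
instantiate : ∀ {k n} {D : Set} (cs : Vec D k) c (ψ : Formula (SetVars (suc k)) n L₂) →
              mapSets (Maybe.map (assign cs)) ψ [ c ]₂ ≡ mapSets (assign (c ∷ cs)) ψ
instantiate cs c = mapSets-fuse λ { nothing → refl ; (just v) → refl }

all₂*-intro : ∀ {n} {Γ : List (Formula ⊥ n L₂)} k {ψ : Formula (SetVars k) n L₂} →
              map relax Γ ⊢ ψ → Γ ⊢ all₂* k ψ
all₂*-intro {Γ = Γ} zero    {ψ} d = subst (_⊢ ψ) relax-id d
  where
  relax-id : map relax Γ ≡ Γ
  relax-id = trans (List.map-cong (mapSets-id λ ()) Γ) (List.map-id Γ)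
all₂*-intro {Γ = Γ} (suc k) {ψ} d = all₂*-intro k (all₂-intro (subst (_⊢ ψ) relax-suc d))
  where
  relax-suc : map relax Γ ≡ map weaken₂ (map relax Γ)
  relax-suc = trans (List.map-cong (sym ∘ weaken₂-relax) Γ) (List.map-∘ Γ)

-- Induction on the prefix: the quantifier of the first argument is the innermost,
-- so the other arguments are instantiated before it.
all∈𝓕*-elim : ∀ {n} {D : Set} {Γ : List (Formula D n L₂)} {k} (cs : Vec D k) →
              (∀ i → Γ ⊢ isFunction (Vec.lookup cs i)) →
              ∀ ψ → Γ ⊢ relax (all∈𝓕* k ψ) → Γ ⊢ mapSets (assign cs) ψ
all∈𝓕*-elim []       fs ψ d = d
all∈𝓕*-elim (c ∷ cs) fs ψ d =
  subst (_ ⊢_) (instantiate cs c ψ)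
    (⇒-elim (all₂-elim (all∈𝓕*-elim cs (fs ∘ suc) _ d) c) (fs zero))

-- The set constants of a formula

-- c is X or one of f₀, …, f_{k-1}.
Below : ℕ → SetConstant → Set
Below k c = constantBound {0} (O ∊ c) ≤ k

constantBound-mapSets : ∀ {C n} {ρ : C → SetConstant} k → (∀ c → Below k (ρ c)) →
                        (φ : Formula C n L₁) → constantBound (mapSets ρ φ) ≤ k
constantBound-mapSets k below falsum  = z≤n
constantBound-mapSets k below (s ≐ t) = z≤n
constantBound-mapSets k below (s ≺ t) = z≤n
constantBound-mapSets {ρ = ρ} k below (t ∊ c) with ρ c | below c
... | X    | _ = z≤n
... | fₛ d | p = p
constantBound-mapSets k below (φ ⇒ ψ) =
  ⊔-lub (constantBound-mapSets k below φ) (constantBound-mapSets k below ψ)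
constantBound-mapSets k below (all φ) = constantBound-mapSets k below φ

toVariable-new : ∀ k → toVariable (suc k) (fₛ k) ≡ nothing
toVariable-new k = cong (if_then nothing else just (toVariable k (fₛ k))) (≡ᵇ-refl k)
  where
  ≡ᵇ-refl : ∀ m → (m ≡ᵇ m) ≡ true
  ≡ᵇ-refl zero    = refl
  ≡ᵇ-refl (suc m) = ≡ᵇ-refl m

toVariable-old : ∀ k c → Below k c → toVariable (suc k) c ≡ just (toVariable k c)
toVariable-old k X      _   = refl
toVariable-old k (fₛ d) d<k =
  cong (if_then nothing else just (toVariable k (fₛ d))) (<⇒≢ᵇ d<k)
  where
  <⇒≢ᵇ : ∀ {m n} → m < n → (m ≡ᵇ n) ≡ false
  <⇒≢ᵇ {zero}  (s≤s _)   = refl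
  <⇒≢ᵇ {suc m} (s≤s m<n) = <⇒≢ᵇ m<n

-- A formula over f₀, …, f_{k-1} does not see the variable added for f_k.
translate-old : ∀ k {n} (φ : Formula SetConstant n L₁) → constantBound φ ≤ k →
                translate (toVariable (suc k)) φ ≡ weaken₂ (translate (toVariable k) φ)
translate-old k falsum       _  = refl
translate-old k (s ≐ t)      _  = refl
translate-old k (s ≺ t)      _  = refl
translate-old k (t ∊ X)      _  = refl
translate-old k (t ∊ fₛ d)   le = cong (t ∊_) (toVariable-old k (fₛ d) le)
translate-old k (φ ⇒ ψ)      le =
  cong₂ _⇒_ (translate-old k φ (m⊔n≤o⇒m≤o _ _ le)) (translate-old k ψ (m⊔n≤o⇒n≤o _ _ le))
translate-old k (all φ)      le = cong all (translate-old k φ le)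

assign⁺ : ∀ {n} {D : Set} {P : D → Set} {ds : Vec D n} →
          VecAll.All P ds → ∀ v → P (assign ds v)
assign⁺ (p ∷ ps) nothing  = p
assign⁺ (p ∷ ps) (just v) = assign⁺ ps v

constantBound-assign : ∀ k {m n} (cs : Vec SetConstant m) → VecAll.All (Below k) cs →
                       (φ : Formula (SetVars m) n L₁) →
                       constantBound (mapSets (assign cs) φ) ≤ k
constantBound-assign k cs below = constantBound-mapSets k (assign⁺ {P = Below k} below)

-- In the formula defining f_k from earlier constants cs, the variable of f_k is
-- the innermost one, just as the value is in the corresponding axiom of 𝓐RA₂.
translate-defining :
  ∀ k {n} (cs : Vec SetConstant n) → VecAll.All (Below k) cs → (F : OperatorFormula n) →
  translate (toVariable (suc k)) (mapSets (assign (fₛ k ∷ cs)) F) ≡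
  mapSets (Maybe.map (assign (Vec.map (toVariable k) cs))) (embed F)
translate-defining k cs below F =
  trans (cong embed (mapSets-fuse agree F)) (sym (mapSets-embed _ F))
  where
  old : ∀ {m} {cs : Vec SetConstant m} → VecAll.All (Below k) cs → ∀ v →
        toVariable (suc k) (assign cs v) ≡ just (assign (Vec.map (toVariable k) cs) v)
  old (b ∷ bs) nothing  = toVariable-old k _ b
  old (b ∷ bs) (just v) = old bs v

  agree : ∀ v → toVariable (suc k) (assign (fₛ k ∷ cs) v) ≡
                Maybe.map (assign (Vec.map (toVariable k) cs)) v
  agree nothing  = toVariable-new k
  agree (just v) = old below v

-- Eliminating the constants one by one

module _ (𝓐 : FunctionAlgebraClass) (𝓔 : Enumeration 𝓐) where

  open Enumeration 𝓔

  -- The sentences of 𝓐RA₂ that supply the existence of the functions f_d,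
  -- together with BASIC.
  axioms : List (Sentence ⊥ L₂)
  axioms = BASIC ++ oracleAxiom ∷ List.tabulate (operatorAxiom ∘ operator 𝓐)

  axioms-ARA₂ : All (ARA₂ 𝓐) axioms
  axioms-ARA₂ = All.++⁺ (All.tabulate basic) (oracleAx ∷ All.tabulate⁺ operatorAx)

  Φ⁺ : ∀ {P : Sentence SetConstant L₁ → Set} k →
       (∀ {d} → d < k → P (defining 𝓐 𝓔 (fₛ d) (derivation d))) →
       (∀ {d} → d < k → P (isFunction (fₛ d))) → All P (Φ 𝓐 𝓔 k)
  Φ⁺ k p q =
    All.concat⁺ (All.map⁺ (All.map (λ d<k → p d<k ∷ q d<k ∷ []) (All.all-upTo k)))

  definition-∈-Φ : ∀ {d k} → d < k → defining 𝓐 𝓔 (fₛ d) (derivation d) ∈ Φ 𝓐 𝓔 k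
  definition-∈-Φ d<k = ∈-concatMap⁺ _ (lose (∈-upTo⁺ d<k) (here refl))

  functional-∈-Φ : ∀ {d k} → d < k → isFunction (fₛ d) ∈ Φ 𝓐 𝓔 k
  functional-∈-Φ d<k = ∈-concatMap⁺ _ (lose (∈-upTo⁺ d<k) (there (here refl)))

  arguments-below : ∀ i ds → VecAll.All (Below (index (op i ds))) (Vec.map (fₛ ∘ index) ds)
  arguments-below i ds = VecAll.map⁺ (VecAll.lookup⁻ (precedes i ds))

  definition-bound : ∀ d → constantBound (defining 𝓐 𝓔 (fₛ d) (derivation d)) ≤ suc d
  definition-bound d = bound (derivation d) (Inverse.strictlyInverseʳ enumeration d)
    where
    bound : ∀ D → index D ≡ d → constantBound (defining 𝓐 𝓔 (fₛ d) D) ≤ suc d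
    bound X∗        _    =
      constantBound-assign (suc d) (fₛ d ∷ X ∷ []) (≤-refl ∷ z≤n ∷ []) oracle
    bound (op i ds) refl =
      constantBound-assign (suc d) (fₛ d ∷ Vec.map (fₛ ∘ index) ds)
        (≤-refl ∷ VecAll.map m≤n⇒m≤1+n (arguments-below i ds))
        (formula (operator 𝓐 i))

  -- Seen as an instance of isFunction 𝐟, the formula contains only fₛ d.
  functional-bound : ∀ d → constantBound {0} (isFunction (fₛ d)) ≤ suc d
  functional-bound d =
    constantBound-assign (suc d) {n = 0} (fₛ d ∷ []) (≤-refl ∷ []) (isFunction 𝐟)

  -- The hypotheses available while X, f₀, …, f_{k-1} are fixed and the later
  -- constants have been removed.
  context : ∀ k → List (Formula (SetVars (suc k)) 0 L₂)
  context k = map relax axioms ++ map (translate (toVariable k)) (Φ 𝓐 𝓔 k)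

  axiom-⊢ : ∀ k {α} → α ∈ axioms → context k ⊢ relax α
  axiom-⊢ k α∈ = hyp (∈-++⁺ˡ (∈-map⁺ relax α∈))

  Φ-⊢ : ∀ k {χ} → χ ∈ Φ 𝓐 𝓔 k → context k ⊢ translate (toVariable k) χ
  Φ-⊢ k χ∈ = hyp (∈-++⁺ʳ (map relax axioms) (∈-map⁺ (translate (toVariable k)) χ∈))

  -- The axiom for the last operation of the k-th derivation, instantiated at the
  -- constants naming its arguments.  These are among f₀, …, f_{k-1}, so they are
  -- already known to be functions.
  value-exists : ∀ k → context k ⊢
    ex∈𝓕 (translate (toVariable (suc k)) (defining 𝓐 𝓔 (fₛ k) (derivation k)))
  value-exists k = value (derivation k) (Inverse.strictlyInverseʳ enumeration k)
    where
    value : ∀ D → index D ≡ k →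
            context k ⊢ ex∈𝓕 (translate (toVariable (suc k)) (defining 𝓐 𝓔 (fₛ k) D))
    value X∗ _ =
      subst (λ F → context k ⊢ ex∈𝓕 F)
        (sym (translate-defining k (X ∷ []) (z≤n ∷ []) oracle))
        (subst (context k ⊢_) (instantiate [] _ (ex∈𝓕 (embed oracle)))
          (all₂-elim (axiom-⊢ k (∈-++⁺ʳ BASIC (here refl))) (toVariable k X)))
    value (op i ds) refl =
      subst (λ F → context k ⊢ ex∈𝓕 F)
        (sym (translate-defining k cs (arguments-below i ds) (formula (operator 𝓐 i))))
        (all∈𝓕*-elim (Vec.map (toVariable k) cs) functions _
          (axiom-⊢ k (∈-++⁺ʳ BASIC (there (∈-tabulate⁺ i)))))
      where
      cs : Vec SetConstant (arity (operator 𝓐 i))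
      cs = Vec.map (fₛ ∘ index) ds

      functions : ∀ j → context k ⊢ isFunction (Vec.lookup (Vec.map (toVariable k) cs) j)
      functions j =
        subst (λ c → context k ⊢ isFunction c)
          (sym (trans (lookup-map j (toVariable k) cs)
                      (cong (toVariable k) (lookup-map j (fₛ ∘ index) ds))))
          (Φ-⊢ k (functional-∈-Φ (precedes i ds j)))

  -- Since f_k does not occur in φ nor in the axioms for earlier constants, it is
  -- an eigenvariable for the existence statement value-exists.
  eliminate : ∀ k φ → constantBound φ ≤ k →
              context (suc k) ⊢ translate (toVariable (suc k)) φ →
              context k ⊢ translate (toVariable k) φ
  eliminate k φ φ≤k d =
    ex₂-elim (value-exists k) (subst (_ ⊢_) (translate-old k φ φ≤k) (cut derivable d))
    where
    Δ : List (Formula (SetVars (suc (suc k))) 0 L₂)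
    Δ = (isFunction nothing ∧
         translate (toVariable (suc k)) (defining 𝓐 𝓔 (fₛ k) (derivation k)))
      ∷ map weaken₂ (context k)

    old : ∀ {χ} → χ ∈ Φ 𝓐 𝓔 k → constantBound χ ≤ k → Δ ⊢ translate (toVariable (suc k)) χ
    old {χ} χ∈ χ≤k = subst (Δ ⊢_) (sym (translate-old k χ χ≤k))
      (hyp (there (∈-map⁺ weaken₂
        (∈-++⁺ʳ (map relax axioms) (∈-map⁺ (translate (toVariable k)) χ∈)))))

    old-axiom : ∀ {α} → α ∈ axioms → Δ ⊢ relax α
    old-axiom {α} α∈ = subst (Δ ⊢_) (weaken₂-relax α)
      (hyp (there (∈-map⁺ weaken₂ (∈-++⁺ˡ (∈-map⁺ relax α∈)))))

    definitions : ∀ {d} → d < suc k →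
                  Δ ⊢ translate (toVariable (suc k)) (defining 𝓐 𝓔 (fₛ d) (derivation d))
    definitions {d} d<1+k with m<1+n⇒m<n∨m≡n d<1+k
    ... | inj₁ d<k  = old (definition-∈-Φ d<k) (≤-trans (definition-bound d) d<k)
    ... | inj₂ refl = ∧-elimʳ (hyp (here refl))

    functions : ∀ {d} → d < suc k → Δ ⊢ translate (toVariable (suc k)) (isFunction (fₛ d))
    functions {d} d<1+k with m<1+n⇒m<n∨m≡n d<1+k
    ... | inj₁ d<k  = old (functional-∈-Φ d<k) (≤-trans (functional-bound d) d<k)
    ... | inj₂ refl = subst (λ c → Δ ⊢ isFunction c) (sym (toVariable-new k))
                        (∧-elimˡ (hyp (here refl)))

    derivable : All (Δ ⊢_) (context (suc k))
    derivable = All.++⁺ (All.map⁺ (All.tabulate old-axiom))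
                        (All.map⁺ (Φ⁺ (suc k) definitions functions))

  eliminate* : ∀ m k φ → constantBound φ ≤ k →
               context (m + k) ⊢ translate (toVariable (m + k)) φ →
               context k ⊢ translate (toVariable k) φ
  eliminate* zero    k φ φ≤k d = d
  eliminate* (suc m) k φ φ≤k d =
    eliminate* m k φ φ≤k (eliminate (m + k) φ (≤-trans φ≤k (m≤n+m k m)) d)

  -- A uniform bound is obtained because a context is a finite list.
  axioms-in-Φ : ∀ {Γ} → All (ARA₁ 𝓐 𝓔) Γ →
                ∃[ K ] (∀ k → K ≤ k → All (_∈ BASIC ++ Φ 𝓐 𝓔 k) Γ)
  axioms-in-Φ []       = 0 , λ _ _ → []
  axioms-in-Φ (a ∷ as) with axioms-in-Φ as
  ... | K , all-in = bound a ⊔ K , λ k le →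
        membership a k (m⊔n≤o⇒m≤o _ _ le) ∷ all-in k (m⊔n≤o⇒n≤o _ _ le)
    where
    bound : ∀ {γ} → ARA₁ 𝓐 𝓔 γ → ℕ
    bound (basic _)      = 0
    bound (definition d) = suc d
    bound (functional d) = suc d

    membership : ∀ {γ} (a : ARA₁ 𝓐 𝓔 γ) k → bound a ≤ k → γ ∈ BASIC ++ Φ 𝓐 𝓔 k
    membership (basic γ∈)     k _   = ∈-++⁺ˡ γ∈
    membership (definition d) k d<k = ∈-++⁺ʳ BASIC (definition-∈-Φ d<k)
    membership (functional d) k d<k = ∈-++⁺ʳ BASIC (functional-∈-Φ d<k)

  -- Formulas of BASIC mention no set, so their translations are again in BASIC.
  axiom-translates : ∀ k {γ} → γ ∈ BASIC ++ Φ 𝓐 𝓔 k → context k ⊢ translate (toVariable k) γ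
  axiom-translates k = All.lookup (All.++⁺ basics (All.tabulate (Φ-⊢ k)))
    where
    basics : All (λ γ → context k ⊢ translate (toVariable k) γ) BASIC
    basics = All.map⁻ {f = translate (toVariable k)} (All.tabulate same)
      where
      same : ∀ {γ} → γ ∈ map (translate (toVariable k)) BASIC → context k ⊢ γ
      same γ∈ = weakening (xs⊆xs++ys (map relax BASIC) _) (hyp γ∈)

theorem9p5 : (𝓐 : FunctionAlgebraClass) (𝓔 : Enumeration 𝓐) →
    ∀ (φ : Sentence SetConstant L₁) → ARA₁ 𝓐 𝓔 ⊩ φ → ARA₂ 𝓐 ⊩ lifted 𝓐 𝓔 φ
theorem9p5 𝓐 𝓔 φ (Γ , Γ-axioms , d) =
  axioms 𝓐 𝓔 , axioms-ARA₂ 𝓐 𝓔 , all₂*-intro (suc k) (⇒-intro (cut context-derivable body))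
  where
  k K : ℕ
  k = constantBound φ
  K = proj₁ (axioms-in-Φ 𝓐 𝓔 Γ-axioms)

  -- Constants f_i with i ≥ K + k may still occur inside the derivation d.  They
  -- are read as X, which is harmless because neither φ nor an axiom in Γ
  -- contains them.
  translated : context 𝓐 𝓔 (K + k) ⊢ translate (toVariable (K + k)) φ
  translated =
    cut (All.map⁺ (All.map (axiom-translates 𝓐 𝓔 (K + k))
                    (proj₂ (axioms-in-Φ 𝓐 𝓔 Γ-axioms) (K + k) (m≤m+n K k))))
        (translate-⊢ (toVariable (K + k)) d)

  body : context 𝓐 𝓔 k ⊢ translate (toVariable k) φ
  body = eliminate* 𝓐 𝓔 K k φ ≤-refl translated

  definitions : Formula (SetVars (suc k)) 0 L₂
  definitions = translate (toVariable k) (⋀ (Φ 𝓐 𝓔 k))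

  context-derivable : All (definitions ∷ map relax (axioms 𝓐 𝓔) ⊢_) (context 𝓐 𝓔 k)
  context-derivable =
    All.++⁺ (All.tabulate (hyp ∘ there))
      (⋀-elim _ (subst (definitions ∷ map relax (axioms 𝓐 𝓔) ⊢_) (translate-⋀ (toVariable k) (Φ 𝓐 𝓔 k)) (hyp (here refl))))
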